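{- Let $G$ be a connected graph, let $\mathcal{P}=\{F_1,\dots,F_t\}$ be any partition of $E(G)$ into $t$ classes, let $A$ be the cycle–class parity matrix of $\mathcal{P}$ with respect to a fixed cycle basis of $G$, and let $\rho=\mathrm{rank}_{\mathbb{F}_2}(A)$. Then: (i) the most generic consistent assignment of generators to classes has dimension $k=t-\rho$: it is given by $g_j=\pi(e_j)$, the images of the standard basis vectors of $\mathbb{Z}_2^t$ under the quotient map $\pi:\mathbb{Z}_2^t\to\mathbb{Z}_2^t/\mathrm{rowspan}(A)\cong\mathbb{Z}_2^k$, and every other consistent assignment is a linear image of it; (ii) the breadth-first-search labeling $\lambda$ under this assignment is conflict-free by construction; (iii) with $S=\{g_j: g_j\neq\mathbf{0}\}$, every path of length $\ell$ in $G$ maps under $\lambda$ to a walk of length $\ell$ in $\mathrm{Cay}(\mathbb{Z}_2^k,S)$; hence $d_{\mathrm{Cay}}(\lambda(u),\lambda(v))\leq d_G(u,v)$ for all $u,v\in V(G)$, so the only possible failure of isometry is a shortcut (a pair with $d_{\mathrm{Cay}}(\lambda(u),\lambda(v))<d_G(u,v)$), never a stretch (a pair with $d_{\mathrm{Cay}}(\lambda(u),\lambda(v))>d_G(u,v)$).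
   Context: Graphs are finite, simple, connected and undirected, with $n$ vertices and $m$ edges; $d_G$ is the shortest-path distance. $\mathrm{class}(e)=j$ means $e\in F_j$. An assignment $g_1,\dots,g_t\in\mathbb{Z}_2^{k'}$ of generators to the classes is consistent if $\sum_{e\in C}g_{\mathrm{class}(e)}=\mathbf{0}$ for every cycle $C$ of $G$; a consistent assignment $(g'_1,\dots,g'_t)$ in $\mathbb{Z}_2^{k'}$ is a linear image of $(g_1,\dots,g_t)$ in $\mathbb{Z}_2^k$ if there is a linear map $L:\mathbb{Z}_2^k\to\mathbb{Z}_2^{k'}$ with $g'_j=L(g_j)$ for all $j$. The labeling induced by an assignment is $\lambda(v)=\sum_{e\in P(r,v)}g_{\mathrm{class}(e)}$, where $P(r,v)$ is a path from a fixed root $r$ to $v$; it is conflict-free (well defined) if it does not depend on the choice of $P(r,v)$. For a cycle basis $B_1,\dots,B_c$ of $G$ ($c=m-n+1$), the cycle–class parity matrix $A\in\mathbb{F}_2^{c\times t}$ is $A[i,j]=|F_j\cap E(B_i)|\bmod 2$. $\mathrm{Cay}(\mathbb{Z}_2^k,S)$ is the graph on $\mathbb{Z}_2^k$ with edges $\{g,g+s\}$, $s\in S$; $d_{\mathrm{Cay}}$ is its shortest-path distance.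
   Formalization: In (iii), a path maps to a walk of length ℓ in Cay only if no edge on it has a class with zero generator; in general edges with zero generator are stationary steps (for K₃ with one class, S is empty and the claim as written fails). -}

module Defs where

open import Algebra.Definitions.RawMonoid using (sum)
open import Algebra.Module.Bundles.Raw using (RawLeftModule)
open import Algebra.Module.Morphism.Structures using (module LeftModuleMorphisms)
open import Data.Bool using (if_then_else_)
open import Data.Fin using (Fin)
open import Data.Fin.Subset as Subset using (Subset; Nonempty; ⁅_⁆; _∪_; _∩_; ∣_∣)
open import Data.List as List using (List; []; _∷_)
open import Data.List.Relation.Unary.Unique.Propositional using (Unique)
open import Data.Nat using (ℕ; zero; suc; _≤_; _<_; _>_; parity)
open import Data.Parity as ℙ using (Parity; 0ℙ; 1ℙ)
open import Data.Product using (Σ; Σ-syntax; ∃; ∃-syntax; ∃₂; ∃!; _×_; _,_; proj₁; proj₂)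
open import Data.Sum using (_⊎_)
open import Data.Vec as Vec using (Vec; lookup; tabulate; replicate; zipWith; _[_]≔_)
open import Data.Vec.Functional using (Vector)
open import Function using (id; _∘_; _⇔_)
open import Level using (0ℓ)
open import Relation.Binary.PropositionalEquality using (_≡_; _≢_)

-- The field 𝔽₂ is Parity.
F₂^_ : ℕ → Set
F₂^ k = Vec Parity k

infixl 6 _+ᵥ_
infixr 7 _*ᵥ_

_+ᵥ_ : ∀ {k} → F₂^ k → F₂^ k → F₂^ k
_+ᵥ_ = zipWith ℙ._+_

_*ᵥ_ : ∀ {k} → Parity → F₂^ k → F₂^ k
a *ᵥ x = Vec.map (a ℙ.*_) x

0ᵥ : ∀ {k} → F₂^ k
0ᵥ = replicate _ 0ℙ

-- Negation is the identity, the characteristic being 2.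
F₂^-module : ℕ → RawLeftModule Parity 0ℓ 0ℓ
F₂^-module k = record
  { Carrierᴹ = F₂^ k
  ; _≈ᴹ_     = _≡_
  ; _+ᴹ_     = _+ᵥ_
  ; _*ₗ_     = _*ᵥ_
  ; 0ᴹ       = 0ᵥ
  ; -ᴹ_      = id
  }

std : ∀ {t} → Fin t → F₂^ t
std j = 0ᵥ [ j ]≔ 1ℙ

Linear : ∀ {k l} → (F₂^ k → F₂^ l) → Set
Linear {k} {l} = IsLeftModuleHomomorphism
  where open LeftModuleMorphisms (F₂^-module k) (F₂^-module l)

∑ : ∀ {k d} → Vector (F₂^ k) d → F₂^ k
∑ {k} = sum (RawLeftModule.+ᴹ-rawMonoid (F₂^-module k))

combination : ∀ {k d} → F₂^ d → Vector (F₂^ k) d → F₂^ k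
combination a B = ∑ (λ i → lookup a i *ᵥ B i)

Span : ∀ {k d} → Vector (F₂^ k) d → F₂^ k → Set
Span B x = ∃[ a ] combination a B ≡ x

LinearlyIndependent : ∀ {k d} → Vector (F₂^ k) d → Set
LinearlyIndependent B = ∀ a → combination a B ≡ 0ᵥ → a ≡ 0ᵥ

IsBasisOf : ∀ {k d} → Vector (F₂^ k) d → (F₂^ k → Set) → Set
IsBasisOf B W = LinearlyIndependent B × (∀ x → W x ⇔ Span B x)

HasDimension : ∀ {k} → (F₂^ k → Set) → ℕ → Set
HasDimension {k} W d = Σ[ B ∈ Vector (F₂^ k) d ] IsBasisOf B W

-- A c × t matrix is the family of its rows.
Matrix : ℕ → ℕ → Set
Matrix c t = Vector (F₂^ t) c

RowSpan : ∀ {c t} → Matrix c t → F₂^ t → Set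
RowSpan = Span

HasRank : ∀ {c t} → Matrix c t → ℕ → Set
HasRank A = HasDimension (RowSpan A)

-- ℤ₂^t / rowspan(A), as a setoid: x and y are identified when their
-- difference x − y = x + y lies in the row span.
Quotient : ∀ {c t} → Matrix c t → RawLeftModule Parity 0ℓ 0ℓ
Quotient {t = t} A = record (F₂^-module t)
  { _≈ᴹ_ = λ x y → RowSpan A (x +ᵥ y) }

-- The quotient map; passing to classes only changes the equality.
π : ∀ {c t} (A : Matrix c t) → F₂^ t → RawLeftModule.Carrierᴹ (Quotient A)
π A = id

infix 4 _≅_

_≅_ : RawLeftModule Parity 0ℓ 0ℓ → RawLeftModule Parity 0ℓ 0ℓ → Set
M ≅ N = Σ[ φ ∈ (Carrierᴹ M → Carrierᴹ N) ] IsLeftModuleIsomorphism φ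
  where
  open RawLeftModule
  open LeftModuleMorphisms M N

data Walk {V : Set} (_~_ : V → V → Set) : ℕ → V → V → Set where
  []  : ∀ {x} → Walk _~_ zero x x
  _∷_ : ∀ {ℓ x y z} → x ~ y → Walk _~_ ℓ y z → Walk _~_ (suc ℓ) x z

vertices : ∀ {V : Set} {_~_ : V → V → Set} {ℓ x y} → Walk _~_ ℓ x y → List V
vertices {x = x} []      = x ∷ []
vertices {x = x} (_ ∷ w) = x ∷ vertices w

Distance : ∀ {V : Set} → (V → V → Set) → V → V → ℕ → Set
Distance _~_ x y d = Walk _~_ d x y × (∀ ℓ → Walk _~_ ℓ x y → d ≤ ℓ)

-- The image under f of the vertex sequence of w is a walk, of the same
-- length, for the relation _≈_.
MapsToWalk : ∀ {V V′ : Set} {_~_ : V → V → Set} {ℓ x y}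
             (_≈_ : V′ → V′ → Set) (f : V → V′) → Walk _~_ ℓ x y → Set
MapsToWalk {ℓ = ℓ} {x} {y} _≈_ f w =
  Σ[ w′ ∈ Walk _≈_ ℓ (f x) (f y) ] vertices w′ ≡ List.map f (vertices w)

module _ {V V′ : Set} (_~_ : V → V → Set) (_≈_ : V′ → V′ → Set) (f : V → V′) where

  -- R holds between the distance of the images (first) and that of u and v;
  -- both distances are asserted to exist, i.e. to be finite.
  ComparePair : (ℕ → ℕ → Set) → V → V → Set
  ComparePair R u v =
    ∃₂ λ d′ d → Distance _≈_ (f u) (f v) d′ × Distance _~_ u v d × R d′ d

  NonExpanding Isometric : Set
  NonExpanding = ∀ u v → ComparePair _≤_ u v
  Isometric    = ∀ u v → ComparePair _≡_ u v

  Shortcut Stretch : V → V → Set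
  Shortcut = ComparePair _<_
  Stretch  = ComparePair _>_

-- Finite simple undirected graphs on Fin n, with the m edges enumerated by
-- Fin m; the order of the two ends of an edge carries no meaning.
record Graph (n m : ℕ) : Set where
  field
    end₁ end₂ : Fin m → Fin n

  Joins : Fin m → Fin n → Fin n → Set
  Joins e u v = (end₁ e ≡ u × end₂ e ≡ v) ⊎ (end₁ e ≡ v × end₂ e ≡ u)

  field
    noLoops       : ∀ e → end₁ e ≢ end₂ e
    noMultiEdges  : ∀ {e e′ u v} → Joins e u v → Joins e′ u v → e ≡ e′

  Adjacent : Fin n → Fin n → Set
  Adjacent u v = ∃[ e ] Joins e u v

  walkEdges : ∀ {ℓ u v} → Walk Adjacent ℓ u v → Subset m
  walkEdges []            = Subset.⊥
  walkEdges ((e , _) ∷ w) = ⁅ e ⁆ ∪ walkEdges w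

  record Path (u v : Fin n) : Set where
    field
      {length} : ℕ
      walk     : Walk Adjacent length u v
      distinct : Unique (vertices walk)

    edges : Subset m
    edges = walkEdges walk

  Connected : Set
  Connected = 0 < n × (∀ u v → Path u v)

  -- A path with at least three vertices, closed up by an edge joining
  -- its ends.
  record Cycle : Set where
    field
      {start end} : Fin n
      path        : Path start end
      long        : 2 ≤ Path.length path
      close       : Adjacent end start

    edges : Subset m
    edges = ⁅ proj₁ close ⁆ ∪ Path.edges path

indicator : ∀ {m} → Subset m → F₂^ m
indicator = Vec.map (λ b → if b then 1ℙ else 0ℙ)

-- The cycle space is the subspace of 𝔽₂^E spanned by the cycles of G.
InCycleSpace : ∀ {n m} → Graph n m → F₂^ m → Set
InCycleSpace G x =
  ∃[ q ] Σ[ C ∈ Vector (Graph.Cycle G) q ] ∑ (indicator ∘ Graph.Cycle.edges ∘ C) ≡ x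

-- For a connected graph the length c is necessarily m − n + 1.
record CycleBasis {n m : ℕ} (G : Graph n m) (c : ℕ) : Set where
  open Graph G
  field
    cycle : Vector Cycle c
    basis : IsBasisOf (indicator ∘ Cycle.edges ∘ cycle) (InCycleSpace G)

record Partition (m t : ℕ) : Set where
  field
    F        : Fin t → Subset m
    nonempty : ∀ j → Nonempty (F j)
    cover    : ∀ e → ∃! _≡_ λ j → e Subset.∈ F j

  class : Fin m → Fin t
  class e = proj₁ (cover e)

parityMatrix : ∀ {n m t c} {G : Graph n m} → Partition m t → CycleBasis G c → Matrix c t
parityMatrix 𝒫 ℬ i =
  tabulate λ j → parity ∣ Partition.F 𝒫 j ∩ Graph.Cycle.edges (CycleBasis.cycle ℬ i) ∣

Assignment : ℕ → ℕ → Set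
Assignment t k = Vector (F₂^ k) t

LinearImage : ∀ {t k k′} → Assignment t k → Assignment t k′ → Set
LinearImage {k = k} {k′} g g′ =
  Σ[ L ∈ (F₂^ k → F₂^ k′) ] Linear L × (∀ j → g′ j ≡ L (g j))

module _ {n m t : ℕ} (G : Graph n m) (𝒫 : Partition m t) where
  open Graph G
  open Partition 𝒫

  classSum : ∀ {k} → Assignment t k → Subset m → F₂^ k
  classSum g X = ∑ (λ e → if lookup X e then g (class e) else 0ᵥ)

  Consistent : ∀ {k} → Assignment t k → Set
  Consistent g = ∀ (C : Cycle) → classSum g (Cycle.edges C) ≡ 0ᵥ

  MostGeneric : ∀ {k} → Assignment t k → Set
  MostGeneric g =
    Consistent g × (∀ {k′} (g′ : Assignment t k′) → Consistent g′ → LinearImage g g′)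

  -- The labeling read off along a chosen path P v from the root to each
  -- vertex v; breadth-first search is one way of choosing P.
  labeling : ∀ {k} → Assignment t k → (r : Fin n) → (∀ v → Path r v) → Fin n → F₂^ k
  labeling g r P v = classSum g (Path.edges (P v))

  ConflictFree : ∀ {k} → Assignment t k → Fin n → Set
  ConflictFree g r =
    ∀ (P P′ : ∀ v → Path r v) v → labeling g r P v ≡ labeling g r P′ v

-- The dimension of an assignment is that of the subspace its generators
-- span.
AssignmentDimension : ∀ {t k} → Assignment t k → ℕ → Set
AssignmentDimension g = HasDimension (Span g)

genericAssignment : ∀ {c t k} (A : Matrix c t) → Quotient A ≅ F₂^-module k → Assignment t k
genericAssignment A (φ , _) j = φ (π A (std j))

nonzeroGenerators : ∀ {t k} → Assignment t k → F₂^ k → Set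
nonzeroGenerators g s = ∃[ j ] (g j ≢ 0ᵥ × g j ≡ s)

-- {x , y} = {x , x + s} for some s ∈ S; symmetric, since s = −s.
Cay : ∀ {k} → (F₂^ k → Set) → F₂^ k → F₂^ k → Set
Cay S x y = ∃[ s ] (S s × y ≡ x +ᵥ s)

{-# OPTIONS --safe #-}
-- Let g be the family of images of the standard basis under the quotient by the row span of A.
-- The sum of any assignment h over an edge set X is ∑ⱼ |Fⱼ ∩ X| hⱼ, so h is consistent exactly
-- when the linear map eⱼ ↦ hⱼ kills the rows of A, i.e. when it factors through the quotient:
-- this is the universal property of g.  Two most generic assignments are linear images of each
-- other, hence span spaces of the same dimension.  Loop erasure writes the sum along a closed
-- walk as a sum over cycles and back-and-forth edges, so consistency makes path sums depend on
-- the ends only.  Therefore an edge of class j moves the label by gⱼ, and a shortest path of G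
-- becomes a walk in the Cayley graph once its stationary steps are dropped.

module Submission where

open import Defs
open import Algebra.Bundles using (AbelianGroup)
open import Algebra.Module.Morphism.Structures using (module LeftModuleMorphisms)
open import Data.Bool using (true; false; if_then_else_)
open import Data.Fin using (Fin; zero; suc)
import Data.Fin.Properties as Fin
open import Data.Fin.Subset as Subset using (Subset; _∈_; _∉_; ⁅_⁆; _∪_; _∩_; ∣_∣)
import Data.Fin.Subset.Properties as Subset
import Data.List as List
import Data.List.Membership.DecPropositional as DecMembership
open import Data.List.Membership.Propositional using () renaming (_∈_ to _∈ₗ_)
import Data.List.Relation.Unary.All as All
import Data.List.Relation.Unary.AllPairs as AllPairs
open import Data.List.Relation.Unary.Any using (here; there)
open import Data.List.Relation.Unary.Unique.Propositional using (Unique)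
open import Data.Nat using (ℕ; zero; suc; _∸_; _≤_; _<_; z≤n; s≤s; parity)
import Data.Nat.Properties as ℕ
open import Data.Parity as ℙ using (Parity; 0ℙ; 1ℙ)
import Data.Parity.Properties as ℙ
open import Data.Product using (Σ-syntax; ∃; ∃-syntax; ∃₂; _×_; _,_; proj₁; proj₂)
open import Data.Sum using (_⊎_; inj₁; inj₂)
open import Data.Vec as Vec using ([]; _∷_; here; there; lookup; tabulate)
import Data.Vec.Properties as Vec
open import Data.Vec.Functional using (Vector)
open import Function using (_∘_; id; Equivalence; mk⇔)
open import Level using (0ℓ)
open import Relation.Binary.Construct.Closure.Reflexive as Refl using (ReflClosure)
open import Relation.Binary.Definitions using (DecidableEquality)
open import Relation.Binary.PropositionalEquality
open import Relation.Nullary using (¬_; Dec; yes; no; contradiction)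
open import Relation.Nullary.Decidable using (map′; ¬?; _×-dec_; _⊎-dec_)
open import Relation.Unary using (Decidable)

open ≡-Reasoning

-- Linear algebra over 𝔽₂

F₂^-abelianGroup : ℕ → AbelianGroup 0ℓ 0ℓ
F₂^-abelianGroup k = record
  { Carrier = F₂^ k
  ; _≈_     = _≡_
  ; _∙_     = _+ᵥ_
  ; ε       = 0ᵥ
  ; _⁻¹     = id
  ; isAbelianGroup = record
    { isGroup = record
      { isMonoid = record
        { isSemigroup = record
          { isMagma = isMagma _+ᵥ_
          ; assoc   = Vec.zipWith-assoc ℙ.+-assoc
          }
        ; identity = Vec.zipWith-identityˡ ℙ.+-identityˡ , Vec.zipWith-identityʳ ℙ.+-identityʳ
        }
      ; inverse = self-inverse , self-inverse
      ; ⁻¹-cong = id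
      }
    ; comm = Vec.zipWith-comm ℙ.+-comm
    }
  }
  where
  self-inverse : ∀ {k} (x : F₂^ k) → x +ᵥ x ≡ 0ᵥ
  self-inverse x =
    trans (cong (x +ᵥ_) (sym (Vec.map-id x))) (Vec.zipWith-inverseʳ {⁻¹ = id} ℙ.p+p≡0ℙ x)

module _ {k : ℕ} where
  open AbelianGroup (F₂^-abelianGroup k) public
    using () renaming (assoc to +ᵥ-assoc; identityˡ to +ᵥ-identityˡ;
      identityʳ to +ᵥ-identityʳ; comm to +ᵥ-comm; inverseˡ to +ᵥ-self)
  open import Algebra.Properties.AbelianGroup (F₂^-abelianGroup k) public
    using () renaming (identityʳ-unique to +ᵥ-identityʳ-unique; x∙y⁻¹≈ε⇒x≈y to x+y≡0⇒x≡y)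
  open import Algebra.Properties.CommutativeMonoid.Sum
    (AbelianGroup.commutativeMonoid (F₂^-abelianGroup k)) public
    using (∑-distrib-+; ∑-comm) renaming (sum-cong-≗ to ∑-cong)

x+[x+y]≡y : ∀ {k} (x y : F₂^ k) → x +ᵥ (x +ᵥ y) ≡ y
x+[x+y]≡y x y = begin
  x +ᵥ (x +ᵥ y) ≡⟨ +ᵥ-assoc x x y ⟨
  x +ᵥ x +ᵥ y   ≡⟨ cong (_+ᵥ y) (+ᵥ-self x) ⟩
  0ᵥ +ᵥ y       ≡⟨ +ᵥ-identityˡ y ⟩
  y             ∎

_≟ᵥ_ : ∀ {k} → DecidableEquality (F₂^ k)
_≟ᵥ_ = Vec.≡-dec ℙ._≟_

0*ᵥ : ∀ {k} (x : F₂^ k) → 0ℙ *ᵥ x ≡ 0ᵥ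
0*ᵥ x = Vec.map-const x 0ℙ

1*ᵥ : ∀ {k} (x : F₂^ k) → 1ℙ *ᵥ x ≡ x
1*ᵥ = Vec.map-id

*ᵥ-distribʳ : ∀ {k} p q (x : F₂^ k) → (p ℙ.+ q) *ᵥ x ≡ p *ᵥ x +ᵥ q *ᵥ x
*ᵥ-distribʳ p q []      = refl
*ᵥ-distribʳ p q (a ∷ x) = cong₂ _∷_ (ℙ.*-distribʳ-+ a p q) (*ᵥ-distribʳ p q x)

*ᵥ-distribˡ : ∀ {k} p (x y : F₂^ k) → p *ᵥ (x +ᵥ y) ≡ p *ᵥ x +ᵥ p *ᵥ y
*ᵥ-distribˡ p []      []      = refl
*ᵥ-distribˡ p (a ∷ x) (b ∷ y) = cong₂ _∷_ (ℙ.*-distribˡ-+ p a b) (*ᵥ-distribˡ p x y)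

-- Over 𝔽₂ additivity already implies linearity.
Additive : ∀ {k l} → (F₂^ k → F₂^ l) → Set
Additive f = ∀ x y → f (x +ᵥ y) ≡ f x +ᵥ f y

module _ {k l} {f : F₂^ k → F₂^ l} (f-+ : Additive f) where

  additive-0 : f 0ᵥ ≡ 0ᵥ
  additive-0 = +ᵥ-identityʳ-unique (f 0ᵥ) (f 0ᵥ)
    (trans (sym (f-+ 0ᵥ 0ᵥ)) (cong f (+ᵥ-self 0ᵥ)))

  additive-* : ∀ p x → f (p *ᵥ x) ≡ p *ᵥ f x
  additive-* 0ℙ x = trans (cong f (0*ᵥ x)) (trans additive-0 (sym (0*ᵥ (f x))))
  additive-* 1ℙ x = trans (cong f (1*ᵥ x)) (sym (1*ᵥ (f x)))

  additive-∑ : ∀ {d} (B : Vector (F₂^ k) d) → f (∑ B) ≡ ∑ (f ∘ B)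
  additive-∑ {zero}  B = additive-0
  additive-∑ {suc d} B = trans (f-+ _ _) (cong (f (B zero) +ᵥ_) (additive-∑ (B ∘ suc)))

  additive-combination : ∀ {d} (a : F₂^ d) B → f (combination a B) ≡ combination a (f ∘ B)
  additive-combination a B =
    trans (additive-∑ λ i → lookup a i *ᵥ B i) (∑-cong λ i → additive-* (lookup a i) (B i))

  additive⇒linear : Linear f
  additive⇒linear = record
    { +ᴹ-isGroupHomomorphism = record
      { isMonoidHomomorphism = record
        { isMagmaHomomorphism = record
          { isRelHomomorphism = record { cong = cong f }
          ; homo = f-+
          }
        ; ε-homo = additive-0
        }
      ; ⁻¹-homo = λ _ → refl
      }
    ; *ₗ-homo = additive-*
    }

linear⇒additive : ∀ {k l} {f : F₂^ k → F₂^ l} → Linear f → Additive f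
linear⇒additive {k} {l} = IsLeftModuleHomomorphism.+ᴹ-homo
  where open LeftModuleMorphisms (F₂^-module k) (F₂^-module l)

combination-additive : ∀ {k d} (B : Vector (F₂^ k) d) → Additive (λ a → combination a B)
combination-additive B a b = trans
  (∑-cong λ i → trans (cong (_*ᵥ B i) (Vec.lookup-zipWith ℙ._+_ i a b))
                      (*ᵥ-distribʳ (lookup a i) (lookup b i) (B i)))
  (∑-distrib-+ (λ i → lookup a i *ᵥ B i) (λ i → lookup b i *ᵥ B i))

combination-cong : ∀ {k d} (a : F₂^ d) {B C : Vector (F₂^ k) d} →
                   (∀ i → B i ≡ C i) → combination a B ≡ combination a C
combination-cong a B≗C = ∑-cong λ i → cong (lookup a i *ᵥ_) (B≗C i)

combination-stdˡ : ∀ {k d} (B : Vector (F₂^ k) d) j → combination (std j) B ≡ B j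
combination-stdˡ B zero = begin
  1ℙ *ᵥ B zero +ᵥ combination 0ᵥ (B ∘ suc)
    ≡⟨ cong₂ _+ᵥ_ (1*ᵥ _) (additive-0 (combination-additive (B ∘ suc))) ⟩
  B zero +ᵥ 0ᵥ ≡⟨ +ᵥ-identityʳ _ ⟩
  B zero       ∎
combination-stdˡ B (suc j) = begin
  0ℙ *ᵥ B zero +ᵥ combination (std j) (B ∘ suc)
    ≡⟨ cong₂ _+ᵥ_ (0*ᵥ _) (combination-stdˡ (B ∘ suc) j) ⟩
  0ᵥ +ᵥ B (suc j) ≡⟨ +ᵥ-identityˡ _ ⟩
  B (suc j)       ∎

combination-stdʳ : ∀ {d} (a : F₂^ d) → combination a std ≡ a
combination-stdʳ []      = refl
combination-stdʳ (p ∷ a) = begin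
  p *ᵥ std zero +ᵥ combination a ((0ℙ ∷_) ∘ std)
    ≡⟨ cong (p *ᵥ std zero +ᵥ_) (additive-combination {f = 0ℙ ∷_} (λ _ _ → refl) a std) ⟨
  p *ᵥ std zero +ᵥ (0ℙ ∷ combination a std)
    ≡⟨ cong₂ _∷_ (trans (ℙ.+-identityʳ _) (ℙ.*-identityʳ p))
        (cong₂ _+ᵥ_ (additive-0 (*ᵥ-distribˡ p)) (combination-stdʳ a)) ⟩
  p ∷ (0ᵥ +ᵥ a)
    ≡⟨ cong (p ∷_) (+ᵥ-identityˡ a) ⟩
  p ∷ a ∎

additive-expand : ∀ {k l} {f : F₂^ k → F₂^ l} → Additive f →
                  ∀ x → f x ≡ combination x (f ∘ std)
additive-expand {f = f} f-+ x =
  trans (cong f (sym (combination-stdʳ x))) (additive-combination f-+ x std)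

combination-zeros : ∀ {k d} (a : F₂^ d) → combination {k} a (λ _ → 0ᵥ) ≡ 0ᵥ
combination-zeros a = sym (additive-combination {f = λ _ → 0ᵥ} (λ _ _ → sym (+ᵥ-self 0ᵥ)) a std)

independent⇒≢0 : ∀ {k d} (B : Vector (F₂^ k) d) → LinearlyIndependent B → ∀ j → B j ≢ 0ᵥ
independent⇒≢0 B ind j Bj≡0 = std≢0 j (ind (std j) (trans (combination-stdˡ B j) Bj≡0))
  where
  std≢0 : ∀ {t} (j : Fin t) → std j ≢ 0ᵥ
  std≢0 zero    ()
  std≢0 (suc j) e = std≢0 j (cong Vec.tail e)

span-generator : ∀ {k d} (B : Vector (F₂^ k) d) i → Span B (B i)
span-generator B i = std i , combination-stdˡ B i

0∈span : ∀ {k d} (B : Vector (F₂^ k) d) → Span B 0ᵥ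
0∈span B = 0ᵥ , additive-0 (combination-additive B)

-- Quotients by independent families

-- Presents `φ` as the quotient of `F₂^ t` by `Span B` without forming classes. Vanishing is asked
-- on generators only; additivity extends it to the span.
record IsCokernel {t d k} (B : Vector (F₂^ t) d) (φ : F₂^ t → F₂^ k) : Set where
  field
    additive   : Additive φ
    vanishes   : ∀ i → φ (B i) ≡ 0ᵥ
    kernel     : ∀ x → φ x ≡ 0ᵥ → Span B x
    surjective : ∀ y → ∃[ x ] φ x ≡ y

-- Gaussian elimination at the first nonzero entry of `z`: the multiple of `z` that clears this
-- coordinate is added, and the coordinate is dropped.
quotient-by-vector : ∀ {d} (z : F₂^ (suc d)) → z ≢ 0ᵥ →
  Σ[ ψ ∈ (F₂^ (suc d) → F₂^ d) ]
    Additive ψ × ψ z ≡ 0ᵥ × (∀ x → ψ x ≡ 0ᵥ → ∃[ p ] p *ᵥ z ≡ x) × (∀ y → ∃[ x ] ψ x ≡ y)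
quotient-by-vector {d} (1ℙ ∷ z) _ = ψ , ψ-+ , ψ-z , ψ-kernel , λ y → 0ℙ ∷ y , lift y
  where
  ψ : F₂^ (suc d) → F₂^ d
  ψ (p ∷ x) = p *ᵥ z +ᵥ x

  ψ-+ : Additive ψ
  ψ-+ (p ∷ x) (q ∷ y) = trans (cong (_+ᵥ (x +ᵥ y)) (*ᵥ-distribʳ p q z)) (interchange _ _ _ _)
    where open import Algebra.Properties.CommutativeSemigroup
            (AbelianGroup.commutativeSemigroup (F₂^-abelianGroup d)) using (interchange)

  ψ-z : ψ (1ℙ ∷ z) ≡ 0ᵥ
  ψ-z = trans (cong (_+ᵥ z) (1*ᵥ z)) (+ᵥ-self z)

  ψ-kernel : ∀ x → ψ x ≡ 0ᵥ → ∃[ p ] p *ᵥ (1ℙ ∷ z) ≡ x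
  ψ-kernel (p ∷ x) e = p , cong₂ _∷_ (ℙ.*-identityʳ p) (x+y≡0⇒x≡y _ _ e)

  lift : ∀ y → 0ℙ *ᵥ z +ᵥ y ≡ y
  lift y = trans (cong (_+ᵥ y) (0*ᵥ z)) (+ᵥ-identityˡ y)
quotient-by-vector {zero} (0ℙ ∷ []) z≢0 = contradiction refl z≢0
quotient-by-vector {suc d} (0ℙ ∷ z) z≢0
  with ψ , ψ-+ , ψ-z , ψ-kernel , ψ-surj ← quotient-by-vector z (z≢0 ∘ cong (0ℙ ∷_)) =
  ψ′ , ψ′-+ , cong (0ℙ ∷_) ψ-z , ψ′-kernel , ψ′-surj
  where
  ψ′ : F₂^ (suc (suc d)) → F₂^ (suc d)
  ψ′ (p ∷ x) = p ∷ ψ x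

  ψ′-+ : Additive ψ′
  ψ′-+ (p ∷ x) (q ∷ y) = cong (p ℙ.+ q ∷_) (ψ-+ x y)

  ψ′-kernel : ∀ x → ψ′ x ≡ 0ᵥ → ∃[ p ] p *ᵥ (0ℙ ∷ z) ≡ x
  ψ′-kernel (p ∷ x) e with refl , ψx≡0 ← Vec.∷-injective e
                      with q , qz≡x ← ψ-kernel x ψx≡0 =
    q , cong₂ _∷_ (ℙ.*-zeroʳ q) qz≡x

  ψ′-surj : ∀ y → ∃[ x ] ψ′ x ≡ y
  ψ′-surj (p ∷ y) with x , ψx≡y ← ψ-surj y = p ∷ x , cong (p ∷_) ψx≡y

module _ {t d k} (B : Vector (F₂^ t) (suc d)) {ψ : F₂^ t → F₂^ k} (ψ-+ : Additive ψ)
         (ψ-kernel : ∀ x → ψ x ≡ 0ᵥ → ∃[ p ] p *ᵥ B zero ≡ x) where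

  -- The combination `y` of the remaining vectors has the same image as `x`, so `y +ᵥ x` lies in the
  -- kernel of `ψ` and is a multiple of `B zero`; in characteristic 2 adding `y` back leaves `x`.
  span-preimage : ∀ a x → combination a (ψ ∘ B ∘ suc) ≡ ψ x →
                  ∃[ p ] combination (p ∷ a) B ≡ x
  span-preimage a x e = p , (begin
    p *ᵥ B zero +ᵥ y ≡⟨ cong (_+ᵥ y) pB₀≡y+x ⟩
    y +ᵥ x +ᵥ y      ≡⟨ +ᵥ-comm _ y ⟩
    y +ᵥ (y +ᵥ x)    ≡⟨ x+[x+y]≡y y x ⟩
    x                ∎)
    where
    y = combination a (B ∘ suc)

    ψ[y+x]≡0 : ψ (y +ᵥ x) ≡ 0ᵥ
    ψ[y+x]≡0 = begin
      ψ (y +ᵥ x) ≡⟨ ψ-+ y x ⟩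
      ψ y +ᵥ ψ x ≡⟨ cong (_+ᵥ ψ x) (trans (additive-combination ψ-+ a (B ∘ suc)) e) ⟩
      ψ x +ᵥ ψ x ≡⟨ +ᵥ-self (ψ x) ⟩
      0ᵥ         ∎

    p = proj₁ (ψ-kernel (y +ᵥ x) ψ[y+x]≡0)
    pB₀≡y+x = proj₂ (ψ-kernel (y +ᵥ x) ψ[y+x]≡0)

  -- Taking `x` to be zero in `span-preimage` lifts a relation among the images to one of `B` with
  -- the same tail.
  image-independent : LinearlyIndependent B → LinearlyIndependent (ψ ∘ B ∘ suc)
  image-independent ind a e
    with p , pa≡0 ← span-preimage a 0ᵥ (trans e (sym (additive-0 ψ-+))) =
    cong Vec.tail (ind (p ∷ a) pa≡0)

-- Kill the independent vectors one at a time; each lowers the dimension by one.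
cokernel : ∀ {t ρ} (B : Vector (F₂^ t) ρ) → LinearlyIndependent B →
           ∃ (IsCokernel {k = t ∸ ρ} B)
cokernel {ρ = zero} B _ = id , record
  { additive   = λ _ _ → refl
  ; vanishes   = λ ()
  ; kernel     = λ x x≡0 → [] , sym x≡0
  ; surjective = λ y → y , refl
  }
-- `F₂^ zero` has a single vector, so a nonempty family there satisfies a nontrivial relation.
cokernel {zero} {suc ρ} B ind with combination (std zero) B in eq
... | [] with () ← ind (std zero) eq
cokernel {suc t} {suc ρ} B ind
  with ψ , ψ-+ , ψ-B₀ , ψ-kernel , ψ-surj ← quotient-by-vector (B zero) (independent⇒≢0 B ind zero)
  with φ , isCokernel ← cokernel (ψ ∘ B ∘ suc) (image-independent B ψ-+ ψ-kernel ind) =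
  φ ∘ ψ , record
  { additive   = λ x y → trans (cong φ (ψ-+ x y)) (additive (ψ x) (ψ y))
  ; vanishes   = λ { zero → trans (cong φ ψ-B₀) (additive-0 additive) ; (suc i) → vanishes i }
  ; kernel     = kernel′
  ; surjective = surjective′
  }
  where
  open IsCokernel isCokernel

  kernel′ : ∀ x → φ (ψ x) ≡ 0ᵥ → Span B x
  kernel′ x e with a , a≡ψx ← kernel (ψ x) e
              with p , pa≡x ← span-preimage B ψ-+ ψ-kernel a x a≡ψx = p ∷ a , pa≡x

  surjective′ : ∀ y → ∃[ x ] φ (ψ x) ≡ y
  surjective′ y with z , φz≡y ← surjective y
                with x , ψx≡z ← ψ-surj z = x , trans (cong φ ψx≡z) φz≡y

-- The quotient setoid and its generic assignment

-- A rank witness contains a basis `B` of the row span; replacing `A` by `B` gives an independent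
-- family, whose cokernel has dimension `t ∸ ρ`.
quotient≅ : ∀ {c t ρ} (A : Matrix c t) → HasRank A ρ → Quotient A ≅ F₂^-module (t ∸ ρ)
quotient≅ {t = t} A (B , ind , spans) with φ , isCokernel ← cokernel B ind = φ , record
  { isLeftModuleMonomorphism = record
    { isLeftModuleHomomorphism = record
      { +ᴹ-isGroupHomomorphism = record
        { isMonoidHomomorphism = record
          { isMagmaHomomorphism = record
            { isRelHomomorphism = record { cong = φ-cong _ _ }
            ; homo = additive
            }
          ; ε-homo = additive-0 additive
          }
        ; ⁻¹-homo = λ _ → refl
        }
      ; *ₗ-homo = additive-* additive
      }
    ; injective = λ {x} {y} e → Equivalence.from (spans (x +ᵥ y))
        (kernel _ (trans (additive x y) (trans (cong (_+ᵥ φ y) e) (+ᵥ-self _))))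
    }
  ; surjective = λ y → proj₁ (surjective y) ,
      λ {z} z≈x → trans (φ-cong z _ z≈x) (proj₂ (surjective y))
  }
  where
  open IsCokernel isCokernel

  φ-cong : ∀ x y → RowSpan A (x +ᵥ y) → φ x ≡ φ y
  φ-cong x y x≈y with a , a≡x+y ← Equivalence.to (spans (x +ᵥ y)) x≈y =
    x+y≡0⇒x≡y _ _ (begin
      φ x +ᵥ φ y               ≡⟨ additive x y ⟨
      φ (x +ᵥ y)               ≡⟨ cong φ a≡x+y ⟨
      φ (combination a B)      ≡⟨ additive-combination additive a B ⟩
      combination a (φ ∘ B)    ≡⟨ combination-cong a vanishes ⟩
      combination a (λ _ → 0ᵥ) ≡⟨ combination-zeros a ⟩
      0ᵥ                       ∎)

module _ {c t k} (A : Matrix c t) (iso : Quotient A ≅ F₂^-module k) where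
  open LeftModuleMorphisms (Quotient A) (F₂^-module k)
  private
    φ = proj₁ iso
    module φ = IsLeftModuleIsomorphism (proj₂ iso)

  generic : Assignment t k
  generic = genericAssignment A iso

  generic-combination : ∀ x → φ x ≡ combination x generic
  generic-combination = additive-expand φ.+ᴹ-homo

  -- The quotient identifies a row with `0ᵥ`, since their difference lies in the row span, and `φ`
  -- respects this identification.
  generic-kills-rows : ∀ i → combination (A i) generic ≡ 0ᵥ
  generic-kills-rows i = begin
    combination (A i) generic ≡⟨ generic-combination (A i) ⟨
    φ (A i)
      ≡⟨ φ.⟦⟧-cong (subst (RowSpan A) (sym (+ᵥ-identityʳ (A i))) (span-generator A i)) ⟩
    φ 0ᵥ                      ≡⟨ φ.0ᴹ-homo ⟩
    0ᵥ                        ∎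

  -- Only a choice of preimages: nothing makes it additive, so additivity of maps built from it has
  -- to be proved separately.
  generic-section : F₂^ k → F₂^ t
  generic-section y = proj₁ (φ.surjective y)

  generic-section-inverse : ∀ y → combination (generic-section y) generic ≡ y
  generic-section-inverse y = trans (sym (generic-combination _))
    (proj₂ (φ.surjective y) (subst (RowSpan A) (sym (+ᵥ-self (generic-section y))) (0∈span A)))

  -- `L` lifts a vector to coefficients on the classes and evaluates them on `h`. Two lifts differ
  -- by a vector of the row span, which `h` kills, so the choice of lift does not matter.
  generic-universal : ∀ {l} (h : Assignment t l) → (∀ i → combination (A i) h ≡ 0ᵥ) →
                      LinearImage generic h
  generic-universal h h-kills =
    L , additive⇒linear L-+ , λ j → begin
      h j                   ≡⟨ combination-stdˡ h j ⟨
      combination (std j) h ≡⟨ combination-factors (std j) (generic-section (generic j))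
                                 (trans (combination-stdˡ generic j)
                                        (sym (generic-section-inverse (generic j)))) ⟩
      L (generic j)         ∎
    where
    L = λ y → combination (generic-section y) h

    span-kills : ∀ x → RowSpan A x → combination x h ≡ 0ᵥ
    span-kills x (a , refl) = begin
      combination (combination a A) h           ≡⟨ additive-combination (combination-additive h) a A ⟩
      combination a (λ i → combination (A i) h) ≡⟨ combination-cong a h-kills ⟩
      combination a (λ _ → 0ᵥ)                  ≡⟨ combination-zeros a ⟩
      0ᵥ                                        ∎

    combination-factors : ∀ x y → combination x generic ≡ combination y generic →
                          combination x h ≡ combination y h
    combination-factors x y e = x+y≡0⇒x≡y _ _ (trans (sym (combination-additive h x y))
      -- `φ.injective` returns equality in the quotient, which is by definition membership of
      -- `x +ᵥ y` in the row span.
      (span-kills (x +ᵥ y)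
        (φ.injective (trans (generic-combination x) (trans e (sym (generic-combination y)))))))

    L-+ : Additive L
    L-+ x y = trans
      -- The lift of a sum and the sum of the lifts may differ, but they have the same image.
      (combination-factors (s (x +ᵥ y)) (s x +ᵥ s y) (begin
        combination (s (x +ᵥ y)) generic
          ≡⟨ generic-section-inverse (x +ᵥ y) ⟩
        x +ᵥ y
          ≡⟨ cong₂ _+ᵥ_ (generic-section-inverse x) (generic-section-inverse y) ⟨
        combination (s x) generic +ᵥ combination (s y) generic
          ≡⟨ combination-additive generic (s x) (s y) ⟨
        combination (s x +ᵥ s y) generic ∎))
      (combination-additive h (s x) (s y))
      where s = generic-section

  -- A retraction of h back onto the generic assignment makes F₂^ k → Span h injective.
  generic-retract-dimension : ∀ {l} (h : Assignment t l) →
    LinearImage generic h → LinearImage h generic → AssignmentDimension h k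
  generic-retract-dimension h (M , M-linear , h≡Mg) (L , L-linear , g≡Lh) =
    M ∘ std , independent , λ x → mk⇔ (to x) (from x)
    where
    M-+ = linear⇒additive M-linear
    L-+ = linear⇒additive L-linear

    M-combination : ∀ a → combination a (M ∘ std) ≡ M a
    M-combination a = sym (additive-expand M-+ a)

    -- `L ∘ M` fixes each generic generator, and these span `F₂^ k`.
    L∘M : ∀ y → L (M y) ≡ y
    L∘M y = begin
      L (M y)                         ≡⟨ cong (L ∘ M) (generic-section-inverse y) ⟨
      L (M (combination s generic))   ≡⟨ cong L (additive-combination M-+ s generic) ⟩
      L (combination s (M ∘ generic)) ≡⟨ additive-combination L-+ s (M ∘ generic) ⟩
      combination s (L ∘ M ∘ generic)
        ≡⟨ combination-cong s (λ j → trans (g≡Lh j) (cong L (h≡Mg j))) ⟨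
      combination s generic           ≡⟨ generic-section-inverse y ⟩
      y                               ∎
      where s = generic-section y

    independent : LinearlyIndependent (M ∘ std)
    independent a e = begin
      a       ≡⟨ L∘M a ⟨
      L (M a) ≡⟨ cong L (trans (sym (M-combination a)) e) ⟩
      L 0ᵥ    ≡⟨ additive-0 L-+ ⟩
      0ᵥ      ∎

    to : ∀ x → Span h x → Span (M ∘ std) x
    to x (a , refl) = combination a generic , (begin
      combination (combination a generic) (M ∘ std) ≡⟨ M-combination _ ⟩
      M (combination a generic)                     ≡⟨ additive-combination M-+ a generic ⟩
      combination a (M ∘ generic)                   ≡⟨ combination-cong a h≡Mg ⟨
      combination a h                               ∎)

    from : ∀ x → Span (M ∘ std) x → Span h x
    from x (a , refl) = generic-section a , (begin
      combination s h             ≡⟨ combination-cong s h≡Mg ⟩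
      combination s (M ∘ generic) ≡⟨ additive-combination M-+ s generic ⟨
      M (combination s generic)   ≡⟨ cong M (generic-section-inverse a) ⟩
      M a                         ≡⟨ M-combination a ⟨
      combination a (M ∘ std)     ∎)
      where s = generic-section a

-- Sums over edge sets

-- Allows arbitrary edge weights; `classSum` is the case `g ∘ class` by definition, so results here
-- apply to assignments directly.
edgeSum : ∀ {m k} → Assignment m k → Subset m → F₂^ k
edgeSum h X = ∑ (λ e → if lookup X e then h e else 0ᵥ)

edgeSum-combination : ∀ {m k} (h : Assignment m k) X → edgeSum h X ≡ combination (indicator X) h
edgeSum-combination h X = ∑-cong λ e →
  trans (scale (lookup X e) (h e)) (cong (_*ᵥ h e) (sym (Vec.lookup-map e _ X)))
  where
  scale : ∀ {k} b (x : F₂^ k) → (if b then x else 0ᵥ) ≡ (if b then 1ℙ else 0ℙ) *ᵥ x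
  scale false x = sym (0*ᵥ x)
  scale true  x = sym (1*ᵥ x)

indicator-⊥ : ∀ m → indicator (Subset.⊥ {m}) ≡ 0ᵥ
indicator-⊥ m = Vec.map-replicate _ _ m

-- Freshness is essential: union is idempotent, whereas adding `std e` twice cancels.
indicator-insert : ∀ {m} {e : Fin m} {X} → e ∉ X → indicator (⁅ e ⁆ ∪ X) ≡ std e +ᵥ indicator X
indicator-insert {e = zero}  {true  ∷ X} e∉X = contradiction here e∉X
indicator-insert {e = zero}  {false ∷ X} e∉X = cong (1ℙ ∷_)
  (trans (cong indicator (Subset.∪-identityˡ X)) (sym (+ᵥ-identityˡ (indicator X))))
indicator-insert {e = suc e} {x ∷ X}     e∉X = cong (_ ∷_) (indicator-insert (e∉X ∘ there))

indicator-∩ : ∀ {m} (X Y : Subset m) e →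
              lookup (indicator (X ∩ Y)) e ≡ lookup (indicator Y) e ℙ.* lookup (indicator X) e
indicator-∩ (true  ∷ X) (true  ∷ Y) zero = refl
indicator-∩ (true  ∷ X) (false ∷ Y) zero = refl
indicator-∩ (false ∷ X) (true  ∷ Y) zero = refl
indicator-∩ (false ∷ X) (false ∷ Y) zero = refl
indicator-∩ (_ ∷ X) (_ ∷ Y) (suc e) = indicator-∩ X Y e

module _ {m k} (h : Assignment m k) where

  edgeSum-⊥ : edgeSum h Subset.⊥ ≡ 0ᵥ
  edgeSum-⊥ = trans (edgeSum-combination h Subset.⊥)
    (trans (cong (λ a → combination a h) (indicator-⊥ m)) (additive-0 (combination-additive h)))

  edgeSum-insert : ∀ {e X} → e ∉ X → edgeSum h (⁅ e ⁆ ∪ X) ≡ h e +ᵥ edgeSum h X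
  edgeSum-insert {e} {X} e∉X = begin
    edgeSum h (⁅ e ⁆ ∪ X)                     ≡⟨ edgeSum-combination h (⁅ e ⁆ ∪ X) ⟩
    combination (indicator (⁅ e ⁆ ∪ X)) h     ≡⟨ cong (λ a → combination a h) (indicator-insert e∉X) ⟩
    combination (std e +ᵥ indicator X) h      ≡⟨ combination-additive h (std e) (indicator X) ⟩
    combination (std e) h +ᵥ combination (indicator X) h
      ≡⟨ cong₂ _+ᵥ_ (combination-stdˡ h e) (sym (edgeSum-combination h X)) ⟩
    h e +ᵥ edgeSum h X                        ∎

-- Turns the counting in the parity matrix into a sum over edges, ready for an exchange of
-- summations.
parity-* : ∀ {m k} (X : Subset m) (x : F₂^ k) →
           parity ∣ X ∣ *ᵥ x ≡ combination (indicator X) (λ _ → x)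
parity-* []          x = 0*ᵥ x
parity-* (false ∷ X) x = begin
  parity ∣ X ∣ *ᵥ x ≡⟨ parity-* X x ⟩
  y                 ≡⟨ +ᵥ-identityˡ y ⟨
  0ᵥ +ᵥ y           ≡⟨ cong (_+ᵥ y) (0*ᵥ x) ⟨
  0ℙ *ᵥ x +ᵥ y      ∎
  where y = combination (indicator X) (λ _ → x)
parity-* (true ∷ X) x = begin
  parity (suc ∣ X ∣) *ᵥ x        ≡⟨ cong (_*ᵥ x) (ℙ.+-homo-+ 1 ∣ X ∣) ⟩
  (1ℙ ℙ.+ parity ∣ X ∣) *ᵥ x     ≡⟨ *ᵥ-distribʳ 1ℙ (parity ∣ X ∣) x ⟩
  1ℙ *ᵥ x +ᵥ parity ∣ X ∣ *ᵥ x   ≡⟨ cong (1ℙ *ᵥ x +ᵥ_) (parity-* X x) ⟩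
  1ℙ *ᵥ x +ᵥ combination (indicator X) (λ _ → x) ∎

*ᵥ-assoc : ∀ {k} p q (x : F₂^ k) → (p ℙ.* q) *ᵥ x ≡ p *ᵥ (q *ᵥ x)
*ᵥ-assoc p q x = trans (Vec.map-cong (ℙ.*-assoc p q) x) (Vec.map-∘ (p ℙ.*_) (q ℙ.*_) x)

-- Class parities and cycle bases

module _ {m t} (𝒫 : Partition m t) where
  open Partition 𝒫

  -- Each edge lies in exactly one class, so its memberships form a standard basis vector; in the
  -- double count this collapses the sum over classes to a single term.
  membership-std : ∀ e j → lookup (indicator (F j)) e ≡ lookup (std (class e)) j
  membership-std e j with j Fin.≟ class e
  ... | yes refl = begin
    lookup (indicator (F j)) e          ≡⟨ Vec.lookup-map e _ (F j) ⟩
    (if lookup (F j) e then 1ℙ else 0ℙ)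
      ≡⟨ cong (λ b → if b then 1ℙ else 0ℙ) (Vec.[]=⇒lookup (proj₁ (proj₂ (cover e)))) ⟩
    1ℙ                                  ≡⟨ Vec.lookup∘update j 0ᵥ 1ℙ ⟨
    lookup (std j) j                    ∎
  ... | no j≢c = begin
    lookup (indicator (F j)) e          ≡⟨ Vec.lookup-map e _ (F j) ⟩
    (if lookup (F j) e then 1ℙ else 0ℙ)
      ≡⟨ cong (λ b → if b then 1ℙ else 0ℙ) (e∉F (lookup (F j) e) refl) ⟩
    0ℙ                                  ≡⟨ Vec.lookup-replicate j 0ℙ ⟨
    lookup 0ᵥ j                         ≡⟨ Vec.lookup∘update′ j≢c 0ᵥ 1ℙ ⟨
    lookup (std (class e)) j            ∎
    where
    e∉F : ∀ b → lookup (F j) e ≡ b → b ≡ false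
    e∉F false _  = refl
    e∉F true  eq = contradiction (sym (proj₂ (proj₂ (cover e)) (Vec.lookup⇒[]= e (F j) eq))) j≢c

  -- Row `i` of the parity matrix is by definition this vector for the edge set of basis cycle `i`.
  classParity : Subset m → F₂^ t
  classParity X = tabulate λ j → parity ∣ F j ∩ X ∣

  -- Double counting over pairs of an edge of X and its class.
  classParity-combination : ∀ {k} (h : Assignment t k) X →
    combination (classParity X) h ≡ edgeSum (h ∘ class) X
  classParity-combination h X = begin
    combination (classParity X) h
      ≡⟨ ∑-cong (λ j → trans (cong (_*ᵥ h j) (Vec.lookup∘tabulate _ j)) (parity-* (F j ∩ X) (h j))) ⟩
    ∑ (λ j → ∑ (λ e → lookup (indicator (F j ∩ X)) e *ᵥ h j))
      ≡⟨ ∑-cong (λ j → ∑-cong λ e → split e j) ⟩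
    ∑ (λ j → ∑ (λ e → x e *ᵥ (s e j *ᵥ h j)))
      ≡⟨ ∑-comm (λ j e → x e *ᵥ (s e j *ᵥ h j)) ⟩
    ∑ (λ e → ∑ (λ j → x e *ᵥ (s e j *ᵥ h j)))
      ≡⟨ ∑-cong (λ e → additive-∑ (*ᵥ-distribˡ (x e)) (λ j → s e j *ᵥ h j)) ⟨
    ∑ (λ e → x e *ᵥ combination (std (class e)) h)
      ≡⟨ combination-cong (indicator X) (λ e → combination-stdˡ h (class e)) ⟩
    combination (indicator X) (h ∘ class)
      ≡⟨ edgeSum-combination (h ∘ class) X ⟨
    edgeSum (h ∘ class) X ∎
    where
    x : Fin m → Parity
    x = lookup (indicator X)

    s : Fin m → Fin t → Parity
    s e = lookup (std (class e))

    split : ∀ e j → lookup (indicator (F j ∩ X)) e *ᵥ h j ≡ x e *ᵥ (s e j *ᵥ h j)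
    split e j = begin
      lookup (indicator (F j ∩ X)) e *ᵥ h j
        ≡⟨ cong (_*ᵥ h j) (indicator-∩ (F j) X e) ⟩
      (x e ℙ.* lookup (indicator (F j)) e) *ᵥ h j
        ≡⟨ cong (λ p → (x e ℙ.* p) *ᵥ h j) (membership-std e j) ⟩
      (x e ℙ.* s e j) *ᵥ h j
        ≡⟨ *ᵥ-assoc (x e) (s e j) (h j) ⟩
      x e *ᵥ (s e j *ᵥ h j) ∎

module _ {n m c} {G : Graph n m} (ℬ : CycleBasis G c) where
  open Graph G
  open CycleBasis ℬ

  -- The edge sum is linear in the indicator, and the indicator of any cycle is a combination of
  -- those of the basis cycles.
  edgeSum-basis⇒cycles : ∀ {k} (h : Assignment m k) →
    (∀ i → edgeSum h (Cycle.edges (cycle i)) ≡ 0ᵥ) → ∀ C → edgeSum h (Cycle.edges C) ≡ 0ᵥ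
  edgeSum-basis⇒cycles h zero-on-basis C
    with a , a≡C ← Equivalence.to (proj₂ basis (indicator (Cycle.edges C)))
                     -- One cycle on its own is a sum with a single term, which places it in the
                     -- cycle space.
                     (1 , (λ _ → C) , +ᵥ-identityʳ _) = begin
    edgeSum h (Cycle.edges C)                 ≡⟨ edgeSum-combination h (Cycle.edges C) ⟩
    combination (indicator (Cycle.edges C)) h ≡⟨ cong (λ x → combination x h) a≡C ⟨
    combination (combination a B) h           ≡⟨ additive-combination (combination-additive h) a B ⟩
    combination a (λ i → combination (B i) h) ≡⟨ combination-cong a vanishes ⟩
    combination a (λ _ → 0ᵥ)                  ≡⟨ combination-zeros a ⟩
    0ᵥ                                        ∎
    where
    B = indicator ∘ Cycle.edges ∘ cycle

    vanishes : ∀ i → combination (B i) h ≡ 0ᵥ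
    vanishes i =
      trans (sym (edgeSum-combination h (Cycle.edges (cycle i)))) (zero-on-basis i)

-- Walks

module _ {V : Set} {_~_ : V → V → Set} where

  start∈ : ∀ {ℓ x y} (w : Walk _~_ ℓ x y) → x ∈ₗ vertices w
  start∈ []      = here refl
  start∈ (_ ∷ _) = here refl

  end∈ : ∀ {ℓ x y} (w : Walk _~_ ℓ x y) → y ∈ₗ vertices w
  end∈ []      = here refl
  end∈ (_ ∷ w) = there (end∈ w)

  infixr 5 _++ʷ_

  _++ʷ_ : ∀ {ℓ ℓ′ x y z} → Walk _~_ ℓ x y → Walk _~_ ℓ′ y z → ∃[ ℓ″ ] Walk _~_ ℓ″ x z
  []      ++ʷ w′ = _ , w′
  (s ∷ w) ++ʷ w′ = _ , s ∷ proj₂ (w ++ʷ w′)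

  first-distinct : ∀ {ℓ x y z} {s : x ~ y} {w : Walk _~_ ℓ y z} →
                   Unique (vertices (s ∷ w)) → ∀ {v} → v ∈ₗ vertices w → x ≢ v
  first-distinct (x∉ AllPairs.∷ _) = All.lookup x∉

  rest-distinct : ∀ {ℓ x y z} {s : x ~ y} {w : Walk _~_ ℓ y z} →
                  Unique (vertices (s ∷ w)) → Unique (vertices w)
  rest-distinct (_ AllPairs.∷ u) = u

-- Sums along walks and loop erasure

module WalkSums {n m} (G : Graph n m) {k} (h : Assignment m k) where
  open Graph G

  Joins-sym : ∀ {e u v} → Joins e u v → Joins e v u
  Joins-sym (inj₁ p) = inj₂ p
  Joins-sym (inj₂ p) = inj₁ p

  Joins-ends : ∀ {e u v a b} → Joins e u v → Joins e a b → (u ≡ a × v ≡ b) ⊎ (u ≡ b × v ≡ a)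
  Joins-ends (inj₁ (refl , refl)) (inj₁ (p , q)) = inj₁ (p , q)
  Joins-ends (inj₁ (refl , refl)) (inj₂ (p , q)) = inj₂ (p , q)
  Joins-ends (inj₂ (refl , refl)) (inj₁ (p , q)) = inj₂ (q , p)
  Joins-ends (inj₂ (refl , refl)) (inj₂ (p , q)) = inj₁ (q , p)

  Joins-irrefl : ∀ {e u} → ¬ Joins e u u
  Joins-irrefl {e} (inj₁ (p , q)) = noLoops e (trans p (sym q))
  Joins-irrefl {e} (inj₂ (p , q)) = noLoops e (trans p (sym q))

  -- Counts edges with multiplicity, unlike `edgeSum` over `walkEdges`, which is a set.
  walkSum : ∀ {ℓ u v} → Walk Adjacent ℓ u v → F₂^ k
  walkSum []            = 0ᵥ
  walkSum ((e , _) ∷ w) = h e +ᵥ walkSum w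

  walkSum-++ : ∀ {ℓ ℓ′ x y z} (w : Walk Adjacent ℓ x y) (w′ : Walk Adjacent ℓ′ y z) →
               walkSum (proj₂ (w ++ʷ w′)) ≡ walkSum w +ᵥ walkSum w′
  walkSum-++ []            w′ = sym (+ᵥ-identityˡ _)
  walkSum-++ ((e , _) ∷ w) w′ =
    trans (cong (h e +ᵥ_) (walkSum-++ w w′)) (sym (+ᵥ-assoc (h e) _ _))

  reverse : ∀ {ℓ x y} (w : Walk Adjacent ℓ x y) →
            ∃[ ℓ′ ] Σ[ w′ ∈ Walk Adjacent ℓ′ y x ] walkSum w′ ≡ walkSum w
  reverse [] = _ , [] , refl
  reverse ((e , j) ∷ w) with _ , w′ , eq ← reverse w = _ , proj₂ (w′ ++ʷ step) , (begin
    walkSum (proj₂ (w′ ++ʷ step)) ≡⟨ walkSum-++ w′ step ⟩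
    walkSum w′ +ᵥ (h e +ᵥ 0ᵥ)     ≡⟨ cong₂ _+ᵥ_ eq (+ᵥ-identityʳ (h e)) ⟩
    walkSum w +ᵥ h e              ≡⟨ +ᵥ-comm (walkSum w) (h e) ⟩
    h e +ᵥ walkSum w              ∎)
    where step = (e , Joins-sym j) ∷ []

  edge∈⇒end∈ : ∀ {ℓ u v e x y} (w : Walk Adjacent ℓ u v) →
               e ∈ walkEdges w → Joins e x y → x ∈ₗ vertices w
  edge∈⇒end∈ [] e∈ _ = contradiction e∈ Subset.∉⊥
  edge∈⇒end∈ ((e′ , j′) ∷ w) e∈ j with Subset.x∈p∪q⁻ ⁅ e′ ⁆ (walkEdges w) e∈
  ... | inj₂ e∈w = there (edge∈⇒end∈ w e∈w j)
  ... | inj₁ e∈e′ with refl ← Subset.x∈⁅y⁆⇒x≡y e′ e∈e′ with Joins-ends j j′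
  ...   | inj₁ (refl , _) = here refl
  ...   | inj₂ (refl , _) = there (start∈ w)

  -- A repetition of the edge would bring the start `x` back among the later vertices.
  first-edge∉ : ∀ {ℓ x y v e} {j : Joins e x y} (w : Walk Adjacent ℓ y v) →
                Unique (vertices {_~_ = Adjacent} ((e , j) ∷ w)) → e ∉ walkEdges w
  first-edge∉ {j = j} w u e∈w = first-distinct {s = _ , j} {w} u (edge∈⇒end∈ w e∈w j) refl

  -- Distinct vertices force distinct edges, so every multiplicity is one.
  walkSum-edges : ∀ {ℓ u v} (w : Walk Adjacent ℓ u v) → Unique (vertices w) →
                  edgeSum h (walkEdges w) ≡ walkSum w
  walkSum-edges []            u = edgeSum-⊥ h
  walkSum-edges ((e , j) ∷ w) u = trans (edgeSum-insert h (first-edge∉ {j = j} w u))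
    (cong (h e +ᵥ_) (walkSum-edges w (rest-distinct {s = e , j} {w} u)))

  pathSum : ∀ {u v} → Path u v → F₂^ k
  pathSum p = walkSum (Path.walk p)

  pathSum-edges : ∀ {u v} (p : Path u v) → edgeSum h (Path.edges p) ≡ pathSum p
  pathSum-edges p = walkSum-edges (Path.walk p) (Path.distinct p)

  -- If the closing edge were the first step, `y` or `z` would be the final vertex `x`; if it came
  -- later, `y` would be revisited. The second step `s′` is what separates `z` from `x`.
  chord∉ : ∀ {ℓ x y z z′ e} (s : Adjacent y z) (s′ : Adjacent z z′) (w : Walk Adjacent ℓ z′ x) →
           Unique (vertices (s ∷ s′ ∷ w)) → Joins e x y → e ∉ walkEdges (s ∷ s′ ∷ w)
  chord∉ {e = e} (e₁ , j₁) s′ w u j e∈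
    with Subset.x∈p∪q⁻ ⁅ e₁ ⁆ (walkEdges (s′ ∷ w)) e∈
  ... | inj₂ e∈w =
    first-distinct {s = e₁ , j₁} {s′ ∷ w} u (edge∈⇒end∈ (s′ ∷ w) e∈w (Joins-sym j)) refl
  ... | inj₁ e∈e₁ with refl ← Subset.x∈⁅y⁆⇒x≡y e₁ e∈e₁ with Joins-ends j j₁
  ...   | inj₁ (refl , _) = first-distinct {s = e₁ , j₁} {s′ ∷ w} u (end∈ (s′ ∷ w)) refl
  ...   | inj₂ (refl , _) =
    first-distinct {s = s′} {w} (rest-distinct {s = e₁ , j₁} {s′ ∷ w} u) (end∈ w) refl

  trivial-path : ∀ {x} → Path x x
  trivial-path = record { walk = [] ; distinct = All.[] AllPairs.∷ AllPairs.[] }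

  -- Cuts the path at an occurrence of `x`. The inclusion of the first piece's vertices in `w` keeps
  -- that piece simple when an edge is put in front.
  split : ∀ {ℓ x y v} (w : Walk Adjacent ℓ y v) → Unique (vertices w) → x ∈ₗ vertices w →
          Σ[ p ∈ Path y x ] Σ[ q ∈ Path x v ]
            (∀ {z} → z ∈ₗ vertices (Path.walk p) → z ∈ₗ vertices w) ×
            walkSum w ≡ pathSum p +ᵥ pathSum q
  split []      u (here refl) = trivial-path , trivial-path , id , sym (+ᵥ-self 0ᵥ)
  split w@(_ ∷ _) u (here refl) = trivial-path , record { walk = w ; distinct = u } ,
    (λ { (here refl) → here refl }) , sym (+ᵥ-identityˡ _)
  split ((e , j) ∷ w) (y∉ AllPairs.∷ u) (there x∈)
    with p , q , p⊆w , eq ← split w u x∈ =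
    record { walk = (e , j) ∷ Path.walk p
           ; distinct = All.tabulate (λ z∈ → All.lookup y∉ (p⊆w z∈)) AllPairs.∷ Path.distinct p } ,
    q ,
    (λ { (here refl) → here refl ; (there z∈) → there (p⊆w z∈) }) ,
    trans (cong (h e +ᵥ_) eq) (sym (+ᵥ-assoc (h e) (pathSum p) (pathSum q)))

  module _ (cycles-vanish : ∀ C → edgeSum h (Cycle.edges C) ≡ 0ᵥ) where

    -- An empty path would make `e` a loop; a single step must be `e` itself, traversed back, and
    -- cancels; a longer path closes up to a genuine cycle.
    closed-path-vanishes : ∀ {e x y} → Joins e x y → (p : Path y x) → h e +ᵥ pathSum p ≡ 0ᵥ
    closed-path-vanishes j record { walk = [] } = contradiction j Joins-irrefl
    closed-path-vanishes {e} j record { walk = (e′ , j′) ∷ [] }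
      with refl ← noMultiEdges j (Joins-sym j′) = x+[x+y]≡y (h e) 0ᵥ
    closed-path-vanishes {e} j p@record { walk = s ∷ s′ ∷ w ; distinct = u } = begin
      h e +ᵥ pathSum p                ≡⟨ cong (h e +ᵥ_) (pathSum-edges p) ⟨
      h e +ᵥ edgeSum h (Path.edges p) ≡⟨ edgeSum-insert h (chord∉ s s′ w u j) ⟨
      edgeSum h (Cycle.edges C)       ≡⟨ cycles-vanish C ⟩
      0ᵥ                              ∎
      where
      C : Cycle
      C = record { path = p ; long = s≤s (s≤s z≤n) ; close = e , j }

    -- Loop erasure: each erased loop is a cycle or an edge traversed back and forth.
    erase-loops : ∀ {ℓ u v} (w : Walk Adjacent ℓ u v) → Σ[ p ∈ Path u v ] walkSum w ≡ pathSum p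
    erase-loops [] = trivial-path , refl
    erase-loops {u = x} ((e , j) ∷ w) with p , eq ← erase-loops w
      with DecMembership._∈?_ Fin._≟_ x (vertices (Path.walk p))
    ... | no x∉p = record
      { walk     = (e , j) ∷ Path.walk p
      ; distinct = All.tabulate (λ { z∈p refl → x∉p z∈p }) AllPairs.∷ Path.distinct p
      } , cong (h e +ᵥ_) eq
    -- `p₁` leads from the far end of `e` back to `x`; that loop contributes nothing, and only `p₂`
    -- is kept.
    ... | yes x∈p with p₁ , p₂ , _ , eq′ ← split (Path.walk p) (Path.distinct p) x∈p = p₂ , (begin
      h e +ᵥ walkSum w                  ≡⟨ cong (h e +ᵥ_) (trans eq eq′) ⟩
      h e +ᵥ (pathSum p₁ +ᵥ pathSum p₂) ≡⟨ +ᵥ-assoc (h e) (pathSum p₁) (pathSum p₂) ⟨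
      h e +ᵥ pathSum p₁ +ᵥ pathSum p₂   ≡⟨ cong (_+ᵥ pathSum p₂) (closed-path-vanishes j p₁) ⟩
      0ᵥ +ᵥ pathSum p₂                  ≡⟨ +ᵥ-identityˡ (pathSum p₂) ⟩
      pathSum p₂                        ∎)

    path-to-self-vanishes : ∀ {x} (p : Path x x) → pathSum p ≡ 0ᵥ
    path-to-self-vanishes record { walk = [] } = refl
    path-to-self-vanishes record { walk = s ∷ w ; distinct = u } =
      contradiction refl (first-distinct {s = s} {w} u (end∈ w))

    -- `w` followed by `w′` reversed is a closed walk; loop erasure leaves a path from `u` to
    -- itself, which is empty.
    walkSum-unique : ∀ {ℓ ℓ′ u v} (w : Walk Adjacent ℓ u v) (w′ : Walk Adjacent ℓ′ u v) →
                     walkSum w ≡ walkSum w′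
    walkSum-unique w w′ with _ , w″ , eq ← reverse w′
                        with p , eq′ ← erase-loops (proj₂ (w ++ʷ w″)) =
      x+y≡0⇒x≡y _ _ (begin
        walkSum w +ᵥ walkSum w′     ≡⟨ cong (walkSum w +ᵥ_) eq ⟨
        walkSum w +ᵥ walkSum w″     ≡⟨ walkSum-++ w w″ ⟨
        walkSum (proj₂ (w ++ʷ w″))  ≡⟨ eq′ ⟩
        pathSum p                   ≡⟨ path-to-self-vanishes p ⟩
        0ᵥ                          ∎)

    path-edgeSum-unique : ∀ {u v} (p p′ : Path u v) →
                          edgeSum h (Path.edges p) ≡ edgeSum h (Path.edges p′)
    path-edgeSum-unique p p′ = begin
      edgeSum h (Path.edges p)  ≡⟨ pathSum-edges p ⟩
      pathSum p                 ≡⟨ walkSum-unique (Path.walk p) (Path.walk p′) ⟩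
      pathSum p′                ≡⟨ pathSum-edges p′ ⟨
      edgeSum h (Path.edges p′) ∎

    -- `q` is compared with the walk that follows `p` and then `e`; this need not be a path, as `v`
    -- may already lie on `p`.
    path-edgeSum-step : ∀ {e r u v} → Joins e u v → (p : Path r u) (q : Path r v) →
      edgeSum h (Path.edges q) ≡ edgeSum h (Path.edges p) +ᵥ h e
    path-edgeSum-step {e} j p q = begin
      edgeSum h (Path.edges q)        ≡⟨ pathSum-edges q ⟩
      pathSum q                       ≡⟨ walkSum-unique (Path.walk q) (proj₂ (Path.walk p ++ʷ step)) ⟩
      walkSum (proj₂ (Path.walk p ++ʷ step)) ≡⟨ walkSum-++ (Path.walk p) step ⟩
      pathSum p +ᵥ (h e +ᵥ 0ᵥ)        ≡⟨ cong₂ _+ᵥ_ (sym (pathSum-edges p)) (+ᵥ-identityʳ (h e)) ⟩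
      edgeSum h (Path.edges p) +ᵥ h e ∎
      where step = (e , j) ∷ []

-- Distances and maps of walks

-- The known witness `n` bounds the search; each failed test shifts the predicate by one.
least : ∀ {P : ℕ → Set} → Decidable P → ∀ {n} → P n → ∃[ d ] P d × (∀ ℓ → P ℓ → d ≤ ℓ)
least P? {n} Pn with P? 0
... | yes P0 = 0 , P0 , λ _ _ → z≤n
least P? {zero}  Pn | no ¬P0 = contradiction Pn ¬P0
least P? {suc n} Pn | no ¬P0 with d , Pd , d-least ← least (P? ∘ suc) Pn =
  suc d , Pd , λ { zero P0 → contradiction P0 ¬P0 ; (suc ℓ) Pℓ → s≤s (d-least ℓ Pℓ) }

module _ {V : Set} {_~_ : V → V → Set} where

  distance-unique : ∀ {x y d d′} → Distance _~_ x y d → Distance _~_ x y d′ → d ≡ d′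
  distance-unique (w , d≤) (w′ , d′≤) = ℕ.≤-antisym (d≤ _ w′) (d′≤ _ w)

  module _ (_≟_ : DecidableEquality V)
           (step? : ∀ {P : V → Set} → Decidable P → ∀ x → Dec (∃[ y ] x ~ y × P y)) where

    -- Finite branching enters through `step?`, a decidable search of the neighbours, so the
    -- argument covers both `G` and the Cayley graph.
    walk? : ∀ x y → Decidable (λ ℓ → Walk _~_ ℓ x y)
    walk? x y zero    = map′ (λ { refl → [] }) (λ { [] → refl }) (x ≟ y)
    walk? x y (suc ℓ) = map′ (λ (_ , s , w) → s ∷ w) (λ { (s ∷ w) → _ , s , w })
      (step? (λ z → walk? z y ℓ) x)

    distance : ∀ {ℓ x y} → Walk _~_ ℓ x y → ∃[ d ] Distance _~_ x y d
    distance {x = x} {y} = least (walk? x y)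

contract : ∀ {V : Set} {_~_ : V → V → Set} {ℓ x y} → Walk (ReflClosure _~_) ℓ x y →
           ∃[ ℓ′ ] ℓ′ ≤ ℓ × Walk _~_ ℓ′ x y
contract []                = 0 , z≤n , []
contract (Refl.refl ∷ w)   with ℓ , ℓ≤ , w′ ← contract w = ℓ , ℕ.m≤n⇒m≤1+n ℓ≤ , w′
contract (Refl.[ s ] ∷ w)  with ℓ , ℓ≤ , w′ ← contract w = suc ℓ , s≤s ℓ≤ , s ∷ w′

mapWalk : ∀ {V V′ : Set} {_~_ : V → V → Set} {_≈_ : V′ → V′ → Set} {f : V → V′} →
          (∀ {x y} → x ~ y → f x ≈ f y) → ∀ {ℓ x y} (w : Walk _~_ ℓ x y) → MapsToWalk _≈_ f w
mapWalk step []      = [] , refl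
mapWalk step (s ∷ w) with w′ , eq ← mapWalk step w = step s ∷ w′ , cong (_ List.∷_) eq

module _ {n m} (G : Graph n m) where
  open Graph G

  joins? : ∀ e u v → Dec (Joins e u v)
  joins? e u v = (end₁ e Fin.≟ u ×-dec end₂ e Fin.≟ v) ⊎-dec (end₁ e Fin.≟ v ×-dec end₂ e Fin.≟ u)

  adjacent-step? : ∀ {P : Fin n → Set} → Decidable P → ∀ x → Dec (∃[ y ] Adjacent x y × P y)
  adjacent-step? P? x = Fin.any? λ y → Fin.any? (λ e → joins? e x y) ×-dec P? y

module _ {t k} (g : Assignment t k) where

  private
    S = nonzeroGenerators g

  Cay-step : ∀ {j x y} → g j ≢ 0ᵥ → y ≡ x +ᵥ g j → Cay S x y
  Cay-step {j} gj≢0 y≡ = g j , (j , gj≢0 , refl) , y≡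

  -- Every neighbour is `x +ᵥ g j` for some class `j`, so the search runs over the classes.
  Cay-step? : ∀ {P : F₂^ k → Set} → Decidable P → ∀ x → Dec (∃[ y ] Cay S x y × P y)
  Cay-step? P? x = map′
    (λ (j , gj≢0 , Py) → x +ᵥ g j , Cay-step gj≢0 refl , Py)
    (λ { (_ , (_ , (j , gj≢0 , refl) , refl) , Py) → j , gj≢0 , Py })
    (Fin.any? λ j → ¬? (g j ≟ᵥ 0ᵥ) ×-dec P? (x +ᵥ g j))

  Cay-reflStep : ∀ {j x y} → y ≡ x +ᵥ g j → ReflClosure (Cay S) x y
  Cay-reflStep {j} {x} y≡ with g j ≟ᵥ 0ᵥ
  ... | no  gj≢0 = Refl.[ Cay-step gj≢0 y≡ ]
  ... | yes gj≡0 = Refl.reflexive (sym (trans y≡ (trans (cong (x +ᵥ_) gj≡0) (+ᵥ-identityʳ x))))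

-- Isometry, shortcuts and stretches

module _ {V V′ : Set} {_~_ : V → V → Set} {_≈_ : V′ → V′ → Set} {f : V → V′}
         (nonExpanding : NonExpanding _~_ _≈_ f) where

  ¬stretch : ∀ u v → ¬ Stretch _~_ _≈_ f u v
  ¬stretch u v (d′ , d , D′ , D , d<d′) with e′ , e , E′ , E , e′≤e ← nonExpanding u v
    with refl ← distance-unique D′ E′ | refl ← distance-unique D E = ℕ.<⇒≱ d<d′ e′≤e

-- Made constructive by an exhaustive search over vertex pairs: `nonExpanding` supplies concrete
-- distances, so strictness is decidable.
¬isometric⇒shortcut : ∀ {n} {V′ : Set} {_~_ : Fin n → Fin n → Set} {_≈_ : V′ → V′ → Set}
  {f : Fin n → V′} → NonExpanding _~_ _≈_ f → ¬ Isometric _~_ _≈_ f → ∃₂ (Shortcut _~_ _≈_ f)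
¬isometric⇒shortcut {n} {_~_ = _~_} {_≈_} {f} nonExpanding ¬isometric
  with Fin.any? (λ u → Fin.any? (shortcut? u))
  where
  shortcut? : ∀ u v → Dec (proj₁ (nonExpanding u v) < proj₁ (proj₂ (nonExpanding u v)))
  shortcut? u v = _ ℕ.<? _
... | yes (u , v , d′<d) with d′ , d , D′ , D , _ ← nonExpanding u v =
  u , v , d′ , d , D′ , D , d′<d
... | no none = contradiction isometric ¬isometric
  where
  isometric : Isometric _~_ _≈_ f
  isometric u v with nonExpanding u v in eq
  ... | d′ , d , D′ , D , d′≤d = d′ , d , D′ , D , ℕ.≤-antisym d′≤d (ℕ.≮⇒≥ λ d′<d →
    -- `none` speaks of the projections of `nonExpanding u v`; `eq` identifies them with the matched
    -- distances.
    none (u , v , subst (λ (a , b , _) → a < b) (sym eq) d′<d))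

-- The generic labeling of a graph

module _ {n m t c k} (G : Graph n m) (𝒫 : Partition m t) (ℬ : CycleBasis G c)
         (φ : Quotient (parityMatrix 𝒫 ℬ) ≅ F₂^-module k) where
  open Graph G
  open Partition 𝒫

  private
    A = parityMatrix 𝒫 ℬ
    g = genericAssignment A φ
    S = nonzeroGenerators g
    h = g ∘ class

  -- On a basis cycle the class sum is the combination given by a row of `A`, which the quotient
  -- kills; linearity carries this to all cycles.
  generic-consistent : Consistent G 𝒫 g
  generic-consistent = edgeSum-basis⇒cycles ℬ h λ i →
    trans (sym (classParity-combination 𝒫 g (Cycle.edges (CycleBasis.cycle ℬ i))))
          (generic-kills-rows A φ i)

  generic-mostGeneric : MostGeneric G 𝒫 g
  generic-mostGeneric = generic-consistent , λ g′ g′-consistent →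
    -- Consistency on the basis cycles already says that `g′` kills the rows of `A`.
    generic-universal A φ g′ λ i →
      trans (classParity-combination 𝒫 g′ (Cycle.edges (CycleBasis.cycle ℬ i)))
            (g′-consistent (CycleBasis.cycle ℬ i))

  mostGeneric-dimension : ∀ {l} (g′ : Assignment t l) → MostGeneric G 𝒫 g′ →
                          AssignmentDimension g′ k
  mostGeneric-dimension g′ (g′-consistent , g′-universal) =
    generic-retract-dimension A φ g′ (proj₂ generic-mostGeneric g′ g′-consistent)
      (g′-universal g generic-consistent)

  generic-conflictFree : ∀ r → ConflictFree G 𝒫 g r
  generic-conflictFree r P P′ v =
    WalkSums.path-edgeSum-unique G h generic-consistent (P v) (P′ v)

  module _ (r : Fin n) (P : ∀ v → Path r v) where

    private
      lab = labeling G 𝒫 g r P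

    labeling-step : ∀ {e u v} → Joins e u v → lab v ≡ lab u +ᵥ h e
    labeling-step j = WalkSums.path-edgeSum-step G h generic-consistent j (P _) (P _)

    labeling-walk : ∀ {ℓ u v} (w : Walk Adjacent ℓ u v) → MapsToWalk (ReflClosure (Cay S)) lab w
    labeling-walk = mapWalk λ (_ , j) → Cay-reflStep g (labeling-step j)

    labeling-walk-nonzero : ∀ {ℓ u v} (w : Walk Adjacent ℓ u v) →
      (∀ e → e ∈ walkEdges w → h e ≢ 0ᵥ) → MapsToWalk (Cay S) lab w
    labeling-walk-nonzero []            _  = [] , refl
    labeling-walk-nonzero ((e , j) ∷ w) ≢0
      with w′ , eq ← labeling-walk-nonzero w (λ e′ → ≢0 e′ ∘ Subset.q⊆p∪q ⁅ e ⁆ (walkEdges w)) =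
      Cay-step g (≢0 e (Subset.p⊆p∪q (walkEdges w) (Subset.x∈⁅x⁆ e))) (labeling-step j) ∷ w′ ,
      cong (_ List.∷_) eq

    -- The contracted image of a shortest walk is used twice: its existence makes the Cayley
    -- distance finite, and its length bounds that distance.
    labeling-nonExpanding : Connected → NonExpanding Adjacent (Cay S) lab
    labeling-nonExpanding (_ , path) u v
      with d , D ← distance Fin._≟_ (adjacent-step? G) (Path.walk (path u v))
      with ℓ , ℓ≤d , w ← contract (proj₁ (labeling-walk (proj₁ D)))
      with d′ , D′ ← distance _≟ᵥ_ (Cay-step? g) w =
      d′ , d , D′ , D , ℕ.≤-trans (proj₂ D′ ℓ w) ℓ≤d

theorem2p25 :
  ∀ {n m t c ρ : ℕ} (G : Graph n m) → Graph.Connected G →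
  (𝒫 : Partition m t) (ℬ : CycleBasis G c) →
  let open Graph G
      open Partition 𝒫
      A = parityMatrix 𝒫 ℬ
      k = t ∸ ρ
  in
  HasRank A ρ →
  (Quotient A ≅ F₂^-module k) ×
  (∀ (φ : Quotient A ≅ F₂^-module k) →
    let g = genericAssignment A φ
        S = nonzeroGenerators g
    in
    -- (i)
    (MostGeneric G 𝒫 g ×
     (∀ {l} (h : Assignment t l) → MostGeneric G 𝒫 h → AssignmentDimension h k)) ×
    -- (ii)
    (∀ r → ConflictFree G 𝒫 g r) ×
    -- (iii)
    (∀ (r : Fin n) (P : ∀ v → Path r v) →
      let lab = labeling G 𝒫 g r P in
      -- an edge whose class has the zero generator is a stationary step
      (∀ {u v} (p : Path u v) →
        MapsToWalk (ReflClosure (Cay S)) lab (Path.walk p)) ×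
      (∀ {u v} (p : Path u v) → (∀ e → e ∈ Path.edges p → g (class e) ≢ 0ᵥ) →
        MapsToWalk (Cay S) lab (Path.walk p)) ×
      NonExpanding Adjacent (Cay S) lab ×
      (∀ u v → ¬ Stretch Adjacent (Cay S) lab u v) ×
      (¬ Isometric Adjacent (Cay S) lab → ∃₂ λ u v → Shortcut Adjacent (Cay S) lab u v)))
theorem2p25 G connected 𝒫 ℬ rank = quotient≅ (parityMatrix 𝒫 ℬ) rank , λ φ →
  (generic-mostGeneric G 𝒫 ℬ φ , mostGeneric-dimension G 𝒫 ℬ φ) ,
  generic-conflictFree G 𝒫 ℬ φ ,
  λ r P →
    let nonExpanding = labeling-nonExpanding G 𝒫 ℬ φ r P connected in
    (λ p → labeling-walk G 𝒫 ℬ φ r P (Graph.Path.walk p)) ,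
    (λ p → labeling-walk-nonzero G 𝒫 ℬ φ r P (Graph.Path.walk p)) ,
    nonExpanding ,
    ¬stretch nonExpanding ,
    ¬isometric⇒shortcut nonExpanding
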